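{- Let $\mathcal{C}$ be the smallest set of functions of finite arity on $[0,1]$ (i.e. functions $[0,1]^n\to[0,1]$, $n\in\mathbb{N}$) such that: (i) $\mathcal{C}$ contains all projections $p^n_i(x_0,\dots,x_{n-1})=x_i$ ($n\in\mathbb{N}$, $0\le i<n$); (ii) if $g\in\mathcal{C}$ is $n$-ary and $a\in[0,1]$, then $\chi_a(g)\colon \mathbf{x}\mapsto\chi_a(g(\mathbf{x}))$ belongs to $\mathcal{C}$; (iii) if $g_1,g_2\in\mathcal{C}$ are $n$-ary and $b\in[0,1[$, then $\mathbf{x}\mapsto \mathsf{Med}_b(g_1(\mathbf{x}),g_2(\mathbf{x}))$ belongs to $\mathcal{C}$; (iv) if $I$ is a nonempty set with $|I|\le\mathfrak{c}=2^{\aleph_0}$ and $g_i\in\mathcal{C}$, $i\in I$, are all $n$-ary, then the pointwise supremum $\mathbf{x}\mapsto\bigvee_{i\in I}g_i(\mathbf{x})$ belongs to $\mathcal{C}$. Then $\mathcal{C}=\mathsf{Agg}$, i.e. the set of all aggregation functions on $[0,1]$ is generated by the infinitary supremum operation $\bigvee$, the functions $\chi_a$, $a\in[0,1]$, and the $b$-medians $\mathsf{Med}_b$, $b\in[0,1[$.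
   Context: For $n\in\mathbb{N}$, an $n$-ary aggregation function on $[0,1]$ is a function $f\colon[0,1]^n\to[0,1]$ which is nondecreasing (not necessarily strictly) in each coordinate and satisfies $f(0,\dots,0)=0$ and $f(1,\dots,1)=1$. $\mathsf{Agg}^n$ denotes the set of all $n$-ary aggregation functions (for $n=1$ it is not restricted to the identity), and $\mathsf{Agg}=\bigcup_{n\in\mathbb{N}}\mathsf{Agg}^n$. For $a\in[0,1]$, $\chi_a\colon[0,1]\to[0,1]$ is defined by $\chi_a(x)=1$ if $x\ge a$ and $x\neq0$, and $\chi_a(x)=0$ if $x<a$ or $x=0$ (so $\chi_0$ is the characteristic function of $]0,1]$ and, for $a>0$, $\chi_a$ is the characteristic function of $[a,1]$). For $b\in[0,1]$, the $b$-median is $\mathsf{Med}_b(x,y)=\mathsf{Med}(x,y,b)$, the median of the three numbers $x,y,b$. -}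

module Defs where

open import Axiom.ExcludedMiddle using (ExcludedMiddle)
open import Data.Bool.Base using (Bool; T; if_then_else_)
open import Data.Fin.Base using (Fin)
open import Data.Nat.Base using (ℕ)
open import Data.Product.Base using (∃; _×_; _,_)
open import Data.Rational.Base as ℚ using (ℚ; 0ℚ; 1ℚ)
import Data.Rational.Properties as ℚ
open import Data.Sum.Base using (inj₁; inj₂)
open import Data.Vec.Functional using (Vector; updateAt)
open import Function.Base using (const)
open import Function.Bundles using (Func; Injection; _⟨$⟩_)
open import Level using (0ℓ)
open import Relation.Binary.Bundles using (Setoid; TotalOrder)
open import Relation.Binary.PropositionalEquality as ≡ using (subst; _→-setoid_)
open import Relation.Binary.Definitions using (Total; tri<; tri≈; tri>)
open import Relation.Nullary using (¬_; yes; no; contradiction)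
open import Relation.Nullary.Decidable using (⌊_⌋; toWitness; fromWitness; T?)
import Algebra.Construct.NaturalChoice.Max as Max
import Algebra.Construct.NaturalChoice.Min as Min
import Data.Vec.Functional.Relation.Binary.Equality.Setoid as VectorEquality
import Function.Relation.Binary.Setoid.Equality as FuncEquality
import Relation.Binary.Construct.On as On
import Relation.Binary.Properties.TotalOrder as TotalOrderProperties

-- Real numbers as Dedekind cuts, a real being identified with the set of the
-- rationals strictly below it.  Sets of rationals are given by their
-- characteristic functions: under excluded middle (assumed below) these are
-- all the sets of rationals, and ℝ stays in the lowest universe.
record ℝ : Set where
  field
    below     : ℚ → Bool
    inhabited : ∃ λ q → T (below q)
    bounded   : ∃ λ q → ¬ T (below q)
    lower     : ∀ {p q} → p ℚ.< q → T (below q) → T (below p)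
    rounded   : ∀ {q} → T (below q) → ∃ λ r → q ℚ.< r × T (below r)

open ℝ public

infix 4 _≤ᴿ_ _≈ᴿ_

_≤ᴿ_ : ℝ → ℝ → Set
x ≤ᴿ y = ∀ q → T (below x q) → T (below y q)

_≈ᴿ_ : ℝ → ℝ → Set
x ≈ᴿ y = x ≤ᴿ y × y ≤ᴿ x

fromℚ : ℚ → ℝ
fromℚ p = record
  { below     = λ q → ⌊ q ℚ.<? p ⌋
  ; inhabited = p ℚ.- 1ℚ , fromWitness p-1<p
  ; bounded   = p , λ p<p → ℚ.<-irrefl ≡.refl (toWitness p<p)
  ; lower     = λ r<q q<p → fromWitness (ℚ.<-trans r<q (toWitness q<p))
  ; rounded   = λ q<p → let (r , q<r , r<p) = ℚ.<-dense (toWitness q<p)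
                        in r , q<r , fromWitness r<p
  }
  where
  p-1<p : p ℚ.- 1ℚ ℚ.< p
  p-1<p = subst (p ℚ.- 1ℚ ℚ.<_) (ℚ.+-identityʳ p)
            (ℚ.+-monoʳ-< p (ℚ.negative⁻¹ (ℚ.- 1ℚ)))

module Classical (em : ExcludedMiddle 0ℓ) where

  ≤ᴿ-total : Total _≤ᴿ_
  ≤ᴿ-total x y with em {x ≤ᴿ y}
  ... | yes x≤y = inj₁ x≤y
  ... | no  x≰y = inj₂ y≤x
    where
    y≤x : y ≤ᴿ x
    y≤x q q∈y with T? (below x q)
    ... | yes q∈x = q∈x
    ... | no  q∉x = contradiction x≤y x≰y
      where
      x≤y : x ≤ᴿ y
      x≤y p p∈x with ℚ.<-cmp p q
      ... | tri< p<q _ _    = lower y p<q q∈y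
      ... | tri≈ _ p≡q _    = contradiction (subst (λ r → T (below x r)) p≡q p∈x) q∉x
      ... | tri> _ _ q<p    = contradiction (lower x q<p p∈x) q∉x

  ℝ-totalOrder : TotalOrder 0ℓ 0ℓ 0ℓ
  ℝ-totalOrder = record
    { Carrier = ℝ
    ; _≈_ = _≈ᴿ_
    ; _≤_ = _≤ᴿ_
    ; isTotalOrder = record
      { isPartialOrder = record
        { isPreorder = record
          { isEquivalence = record
            { refl  = (λ _ z → z) , (λ _ z → z)
            ; sym   = λ (x≤y , y≤x) → y≤x , x≤y
            ; trans = λ (x≤y , y≤x) (y≤z , z≤y) →
                (λ q z → y≤z q (x≤y q z)) , (λ q z → y≤x q (z≤y q z))
            }
          ; reflexive = λ (x≤y , _) → x≤y
          ; trans = λ x≤y y≤z q z → y≤z q (x≤y q z)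
          }
        ; antisym = _,_
        }
      ; total = ≤ᴿ-total
      }
    }

  record 𝕀 : Set where
    constructor mk𝕀
    field
      value   : ℝ
      0≤value : fromℚ 0ℚ ≤ᴿ value
      value≤1 : value ≤ᴿ fromℚ 1ℚ

  open 𝕀 public

  𝕀-totalOrder : TotalOrder 0ℓ 0ℓ 0ℓ
  𝕀-totalOrder = On.totalOrder ℝ-totalOrder value

  open TotalOrder 𝕀-totalOrder public using (_≈_; _≉_; _≤_)
  open TotalOrderProperties 𝕀-totalOrder public using (_<_)
  open Min 𝕀-totalOrder public using (_⊓_)
  open Max 𝕀-totalOrder public using (_⊔_)

  𝕀-setoid : Setoid 0ℓ 0ℓ
  𝕀-setoid = TotalOrder.Eq.setoid 𝕀-totalOrder

  0≤1 : fromℚ 0ℚ ≤ᴿ fromℚ 1ℚ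
  0≤1 q q<0 = fromWitness (ℚ.<-trans (toWitness q<0) (ℚ.positive⁻¹ 1ℚ))

  0# 1# : 𝕀
  0# = mk𝕀 (fromℚ 0ℚ) (λ _ q∈ → q∈) 0≤1
  1# = mk𝕀 (fromℚ 1ℚ) 0≤1 (λ _ q∈ → q∈)

  χ : 𝕀 → 𝕀 → 𝕀
  χ a x = if ⌊ em {a ≤ x × x ≉ 0#} ⌋ then 1# else 0#

  Med : 𝕀 → 𝕀 → 𝕀 → 𝕀
  Med x y z = (x ⊓ y) ⊔ (y ⊓ z) ⊔ (z ⊓ x)

  IsSupremum : {I : Set} → (I → 𝕀) → 𝕀 → Set
  IsSupremum u s = (∀ i → u i ≤ s) × (∀ t → (∀ i → u i ≤ t) → s ≤ t)

  -- Every nonempty family in 𝕀 has a supremum, so that the relational use of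
  -- suprema in the clause `sup` of 𝒞 below is not a restriction.
  supremum-exists : {I : Set} → I → (u : I → 𝕀) → ∃ (IsSupremum u)
  supremum-exists {I} i₀ u = mk𝕀 s
      (λ q q∈0 → fromWitness (i₀ , 0≤value (u i₀) q q∈0))
      (λ q q∈s → let (i , q∈i) = toWitness q∈s in value≤1 (u i) q q∈i)
    , (λ i q q∈i → fromWitness (i , q∈i))
    , (λ t u≤t q q∈s → let (i , q∈i) = toWitness q∈s in u≤t i q q∈i)
    where
    s : ℝ
    s = record
      { below     = λ q → ⌊ em {∃ λ i → T (below (value (u i)) q)} ⌋
      ; inhabited = let (q , q∈) = inhabited (value (u i₀))
                    in q , fromWitness (i₀ , q∈)
      ; bounded   = 1ℚ , λ 1∈s → let (i , 1∈i) = toWitness 1∈s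
                                 in value≤1 (u i) 1ℚ 1∈i
      ; lower     = λ p<q q∈s → let (i , q∈i) = toWitness q∈s
                                in fromWitness (i , lower (value (u i)) p<q q∈i)
      ; rounded   = λ q∈s → let (i , q∈i) = toWitness q∈s
                                (r , q<r , r∈i) = rounded (value (u i)) q∈i
                            in r , q<r , fromWitness (i , r∈i)
      }

  𝕀^ : ℕ → Setoid 0ℓ 0ℓ
  𝕀^ = VectorEquality.≋-setoid 𝕀-setoid

  Op : ℕ → Set
  Op n = Func (𝕀^ n) 𝕀-setoid

  Op-setoid : ℕ → Setoid 0ℓ 0ℓ
  Op-setoid n = FuncEquality.setoid (𝕀^ n) 𝕀-setoid

  record Agg {n : ℕ} (f : Op n) : Set where
    field
      nondecreasing : ∀ (i : Fin n) (x : Vector 𝕀 n) (y : 𝕀) → x i ≤ y →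
                      f ⟨$⟩ x ≤ f ⟨$⟩ updateAt x i (const y)
      preserves-0   : f ⟨$⟩ const 0# ≈ 0#
      preserves-1   : f ⟨$⟩ const 1# ≈ 1#

  -- Functions are identified when they agree at every point; each clause is
  -- therefore stated for any f pointwise equal to the function it introduces.
  -- In `sup`, a set is a setoid, and having cardinality at most 2^ℵ₀ means
  -- having an injection into the binary sequences.
  data 𝒞 {n : ℕ} : Op n → Set₁ where
    proj : ∀ {f} (i : Fin n) →
           (∀ x → f ⟨$⟩ x ≈ x i) → 𝒞 f
    chi  : ∀ {f g} (a : 𝕀) → 𝒞 g →
           (∀ x → f ⟨$⟩ x ≈ χ a (g ⟨$⟩ x)) → 𝒞 f
    med  : ∀ {f g₁ g₂} (b : 𝕀) → b < 1# → 𝒞 g₁ → 𝒞 g₂ →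
           (∀ x → f ⟨$⟩ x ≈ Med (g₁ ⟨$⟩ x) (g₂ ⟨$⟩ x) b) → 𝒞 f
    sup  : ∀ {f} (I : Setoid 0ℓ 0ℓ) → Setoid.Carrier I →
           Injection I (ℕ →-setoid Bool) →
           (g : Func I (Op-setoid n)) → (∀ i → 𝒞 (g ⟨$⟩ i)) →
           (∀ x → IsSupremum (λ i → (g ⟨$⟩ i) ⟨$⟩ x) (f ⟨$⟩ x)) → 𝒞 f

{-# OPTIONS --safe #-}
module Submission where

open import Defs
open import Axiom.ExcludedMiddle using (ExcludedMiddle)
open import Data.Bool.Base using (Bool; T; if_then_else_)
open import Data.Fin.Base using (Fin; zero; suc; toℕ)
open import Data.Fin.Properties using (_≟_)
open import Data.Integer.Base using (ℤ; +_; -[1+_])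
open import Data.Nat.Base using (ℕ; zero; suc; _+_)
open import Data.Nat.Properties using (+-identityʳ; +-suc; suc-injective)
open import Data.Product.Base using (∃; _×_; _,_; proj₁; proj₂; map)
open import Data.Rational.Base using (ℚ; 0ℚ; ↥_; _/_)
open import Data.Rational.Properties using (↥p/↧p≡p)
open import Data.Unit.Base using (tt)
open import Data.Vec.Functional using (Vector; _∷_; head; tail; updateAt)
open import Data.Vec.Functional.Properties using (updateAt-updates; updateAt-minimal)
open import Function.Base using (id; const; _∘_)
open import Function.Bundles using (Func; _⇔_; mk⇔; _⟨$⟩_)
open import Function.Definitions using (StrictlySurjective)
open import Level using (0ℓ)
open import Relation.Binary.Bundles using (Setoid; TotalOrder)
open import Relation.Binary.Definitions using (Maximum; Minimum)
open import Relation.Binary.PropositionalEquality as ≡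
  using (_≡_; refl; cong; cong₂; subst; _→-setoid_)
open import Relation.Nullary using (¬_; yes; no; contradiction)
open import Relation.Nullary.Decidable using (⌊_⌋)
import Relation.Binary.Construct.On as On

-- An aggregation function f is the pointwise supremum, over the points a ≠ 0, of the
-- step functions taking the value 1 at (1,…,1), the value f(a) at the other x ≥ a, and
-- the value 0 elsewhere.  The indicator of {x ∣ x ≥ a} is a finite meet (that is, Med₀)
-- of functions χ_{aᵢ}(xᵢ), and the step function is the f(a)-median of this indicator
-- and that of {(1,…,1)} (if f(a) = 1 it is the first indicator itself).  The points are
-- at most 2^ℵ₀ many, a point of [0,1]^n being coded by a set of pairs (i , q) ∈ Fin n × ℚ.

-- Countable sets.

Countable : Set → Set
Countable A = ∃ λ (e : ℕ → A) → StrictlySurjective _≡_ e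

countable-map : ∀ {A B} {h : A → B} → StrictlySurjective _≡_ h →
                Countable A → Countable B
countable-map {h = h} h-surj (e , e-surj) = h ∘ e , λ b →
  let (a , ha≡b) = h-surj b
      (k , ek≡a) = e-surj a
  in k , ≡.trans (cong h ek≡a) ha≡b

-- Cantor's walk: down each antidiagonal from `(0 , s)` to `(s , 0)`, then on to `(0 , suc s)`.
nextPair : ℕ × ℕ → ℕ × ℕ
nextPair (a , zero)  = 0 , suc a
nextPair (a , suc b) = suc a , b

unpair : ℕ → ℕ × ℕ
unpair zero    = 0 , 0
unpair (suc k) = nextPair (unpair k)

unpair-surjective : StrictlySurjective _≡_ unpair
unpair-surjective (a , b) = onDiagonal (a + b) a b refl
  where
  -- Lexicographic induction on `s` and `a`, stepping back along the walk: `(0 , suc b)` comes after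
  -- `(b , 0)` on the previous diagonal, `(suc a , b)` after `(a , suc b)` on the same one.
  onDiagonal : ∀ s a b → a + b ≡ s → ∃ λ k → unpair k ≡ (a , b)
  onDiagonal s       zero    zero    _  = 0 , refl
  onDiagonal (suc s) zero    (suc b) eq =
    let (k , k↦) = onDiagonal s b 0 (≡.trans (+-identityʳ b) (suc-injective eq))
    in suc k , cong nextPair k↦
  onDiagonal s       (suc a) b       eq =
    let (k , k↦) = onDiagonal s a (suc b) (≡.trans (+-suc a b) eq)
    in suc k , cong nextPair k↦

countable-ℕ : Countable ℕ
countable-ℕ = id , λ k → k , refl

countable-× : ∀ {A B} → Countable A → Countable B → Countable (A × B)
countable-× (e , e-surj) (e′ , e′-surj) =
  countable-map {h = map e e′}
    (λ (a , b) → let (k , eq) = e-surj a ; (k′ , eq′) = e′-surj b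
                 in (k , k′) , cong₂ _,_ eq eq′)
    (unpair , unpair-surjective)

-- An enumeration by all of `ℕ` forces a nonempty type; numbers beyond `n` are sent to the last
-- element.
countable-Fin : ∀ n → Countable (Fin (suc n))
countable-Fin n = clamp n , λ i → toℕ i , clamp-toℕ n i
  where
  clamp : ∀ n → ℕ → Fin (suc n)
  clamp zero    _       = zero
  clamp (suc n) zero    = zero
  clamp (suc n) (suc k) = suc (clamp n k)

  clamp-toℕ : ∀ n i → clamp n (toℕ i) ≡ i
  clamp-toℕ zero    zero    = refl
  clamp-toℕ (suc n) zero    = refl
  clamp-toℕ (suc n) (suc i) = cong suc (clamp-toℕ n i)

countable-ℤ : Countable ℤ
countable-ℤ = countable-map {h = h} h-surj (countable-× countable-ℕ countable-ℕ)
  where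
  h : ℕ × ℕ → ℤ
  h (m , zero)  = + m
  h (m , suc _) = -[1+ m ]

  h-surj : StrictlySurjective _≡_ h
  h-surj (+ m)    = (m , 0) , refl
  h-surj -[1+ m ] = (m , 1) , refl

countable-ℚ : Countable ℚ
countable-ℚ = countable-map {h = λ (i , d) → i / suc d}
  (λ q → (↥ q , ℚ.denominator-1 q) , ↥p/↧p≡p q)
  (countable-× countable-ℤ countable-ℕ)

-- Indicators, `χ` and medians over a bounded chain.

module BoundedChain
  (em : ExcludedMiddle 0ℓ) (totalOrder : TotalOrder 0ℓ 0ℓ 0ℓ)
  (0# 1# : TotalOrder.Carrier totalOrder)
  (0≤ : Minimum (TotalOrder._≤_ totalOrder) 0#)
  (≤1 : Maximum (TotalOrder._≤_ totalOrder) 1#)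
  (0≉1 : ¬ TotalOrder._≈_ totalOrder 0# 1#)
  where

  open TotalOrder totalOrder using (_≈_; _≉_; _≤_; poset; antisym)
    renaming (Carrier to L; refl to ≤-refl; trans to ≤-trans; reflexive to ≤-reflexive)
  open TotalOrder.Eq totalOrder using (setoid)
    renaming (refl to ≈-refl; reflexive to ≈-reflexive; sym to ≈-sym; trans to ≈-trans)
  open import Algebra.Construct.NaturalChoice.Min totalOrder
  open import Algebra.Construct.NaturalChoice.Max totalOrder
  open import Data.Vec.Functional.Relation.Binary.Equality.Setoid setoid using (≋-setoid)
  open import Relation.Binary.Properties.TotalOrder totalOrder using (_<_)
  open import Relation.Binary.Reasoning.PartialOrder poset

  ite : Set → L → L → L
  ite P u v = if ⌊ em {P} ⌋ then u else v

  ite-true : ∀ {P u v} → P → ite P u v ≡ u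
  ite-true {P} p with em {P}
  ... | yes _ = refl
  ... | no ¬p = contradiction p ¬p

  ite-false : ∀ {P u v} → ¬ P → ite P u v ≡ v
  ite-false {P} ¬p with em {P}
  ... | yes p = contradiction p ¬p
  ... | no _  = refl

  -- The last inequality serves the case where `P` fails and `Q` holds.
  ite-mono : ∀ {P Q u u′ v v′} → (P → Q) → u ≤ u′ → v ≤ v′ → v ≤ u′ →
             ite P u v ≤ ite Q u′ v′
  ite-mono {P} {Q} P→Q u≤u′ v≤v′ v≤u′ with em {P} | em {Q}
  ... | yes _ | yes _ = u≤u′
  ... | yes p | no ¬q = contradiction (P→Q p) ¬q
  ... | no _  | yes _ = v≤u′
  ... | no _  | no _  = v≤v′

  indicator : Set → L
  indicator P = ite P 1# 0#

  indicator-mono : ∀ {P Q} → (P → Q) → indicator P ≤ indicator Q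
  indicator-mono P→Q = ite-mono P→Q ≤-refl ≤-refl (≤1 0#)

  indicator-cong : ∀ {P Q} → (P → Q) → (Q → P) → indicator P ≈ indicator Q
  indicator-cong P→Q Q→P = antisym (indicator-mono P→Q) (indicator-mono Q→P)

  ≤0⇒≈0 : ∀ {x} → x ≤ 0# → x ≈ 0#
  ≤0⇒≈0 {x} x≤0 = antisym x≤0 (0≤ x)

  ≥1⇒≈1 : ∀ {x} → 1# ≤ x → x ≈ 1#
  ≥1⇒≈1 {x} 1≤x = antisym (≤1 x) 1≤x

  ≉0-mono : ∀ {x y} → x ≤ y → x ≉ 0# → y ≉ 0#
  ≉0-mono x≤y x≉0 y≈0 = x≉0 (≤0⇒≈0 (≤-trans x≤y (≤-reflexive y≈0)))

  -- Here and for `Med`, `IsSupremum` and `Op`, the definition unfolds over `𝕀` to that of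
  -- `Classical`, so the clauses of `𝒞` apply without translation.
  χ : L → L → L
  χ a x = indicator (a ≤ x × x ≉ 0#)

  χ-mono : ∀ {a x y} → x ≤ y → χ a x ≤ χ a y
  χ-mono x≤y = indicator-mono λ (a≤x , x≉0) → ≤-trans a≤x x≤y , ≉0-mono x≤y x≉0

  χ-cong : ∀ {a x y} → x ≈ y → χ a x ≈ χ a y
  χ-cong x≈y = antisym (χ-mono (≤-reflexive x≈y)) (χ-mono (≤-reflexive (≈-sym x≈y)))

  Med : L → L → L → L
  Med x y z = (x ⊓ y) ⊔ (y ⊓ z) ⊔ (z ⊓ x)

  Med-mono : ∀ {x x′ y y′} b → x ≤ x′ → y ≤ y′ → Med x y b ≤ Med x′ y′ b
  Med-mono b x≤x′ y≤y′ =
    ⊔-mono-≤ (⊔-mono-≤ (⊓-mono-≤ x≤x′ y≤y′) (⊓-monoˡ-≤ b y≤y′)) (⊓-monoʳ-≤ b x≤x′)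

  Med-cong : ∀ {x x′ y y′} b → x ≈ x′ → y ≈ y′ → Med x y b ≈ Med x′ y′ b
  Med-cong b x≈x′ y≈y′ =
    ⊔-cong (⊔-cong (⊓-cong x≈x′ y≈y′) (⊓-congʳ b y≈y′)) (⊓-congˡ b x≈x′)

  Med-lub : ∀ {x y b z} → x ⊓ y ≤ z → y ⊓ b ≤ z → b ⊓ x ≤ z → Med x y b ≤ z
  Med-lub xy yb bx = ⊔-lub (⊔-lub xy yb) bx

  x⊓y≤Med : ∀ x y b → x ⊓ y ≤ Med x y b
  x⊓y≤Med x y b = ≤-trans (x≤x⊔y (x ⊓ y) (y ⊓ b)) (x≤x⊔y _ (b ⊓ x))

  Med-idem : ∀ x b → Med x x b ≈ x
  Med-idem x b = antisym (Med-lub (x⊓y≤x x x) (x⊓y≤x x b) (x⊓y≤y b x)) (begin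
    x           ≈⟨ ⊓-idem x ⟨
    x ⊓ x       ≤⟨ x⊓y≤Med x x b ⟩
    Med x x b   ∎)

  -- All three pairwise meets lie below `b`, and `y ⊓ b` reaches it.
  Med-between : ∀ {x y b} → x ≤ b → b ≤ y → Med x y b ≈ b
  Med-between {x} {y} {b} x≤b b≤y =
    antisym (Med-lub (x≤y⇒x⊓z≤y y x≤b) (x⊓y≤y y b) (x⊓y≤x b x)) (begin
      b                    ≈⟨ x≤y⇒y⊓x≈x b≤y ⟨
      y ⊓ b                ≤⟨ x≤y⊔x (x ⊓ y) (y ⊓ b) ⟩
      (x ⊓ y) ⊔ (y ⊓ b)    ≤⟨ x≤x⊔y _ (b ⊓ x) ⟩
      Med x y b            ∎)

  -- The two meets with `0#` vanish. This is how medians yield the intersection of two sets.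
  Med-0 : ∀ x y → Med x y 0# ≈ x ⊓ y
  Med-0 x y = antisym
    (Med-lub ≤-refl (≤-trans (x⊓y≤y y 0#) (0≤ (x ⊓ y))) (≤-trans (x⊓y≤x 0# x) (0≤ (x ⊓ y))))
    (x⊓y≤Med x y 0#)

  ⊓-indicator : ∀ P Q → indicator P ⊓ indicator Q ≈ indicator (P × Q)
  ⊓-indicator P Q with em {P}
  ... | yes p = begin-equality
    1# ⊓ indicator Q     ≈⟨ ⊓-identityˡ ≤1 (indicator Q) ⟩
    indicator Q          ≈⟨ indicator-cong (p ,_) proj₂ ⟩
    indicator (P × Q)    ∎
  ... | no ¬p = begin-equality
    0# ⊓ indicator Q     ≈⟨ ⊓-zeroˡ 0≤ (indicator Q) ⟩
    0#                   ≡⟨ ite-false (¬p ∘ proj₁) ⟨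
    indicator (P × Q)    ∎

  -- Aggregation functions and joint monotonicity.

  IsSupremum : {I : Set} → (I → L) → L → Set
  IsSupremum u s = (∀ i → u i ≤ s) × (∀ t → (∀ i → u i ≤ t) → s ≤ t)

  Op : ℕ → Set
  Op n = Func (≋-setoid n) setoid

  infix 4 _⊑_
  _⊑_ : ∀ {n} → Vector L n → Vector L n → Set
  x ⊑ y = ∀ i → x i ≤ y i

  ⊑-updateAt : ∀ {n} i (x : Vector L n) y → x i ≤ y → x ⊑ updateAt x i (const y)
  ⊑-updateAt i x y xᵢ≤y j with i ≟ j
  ... | yes refl = subst (x i ≤_) (≡.sym (updateAt-updates i x)) xᵢ≤y
  ... | no i≢j   =
    ≤-reflexive (≈-reflexive (≡.sym (updateAt-minimal j i x (i≢j ∘ ≡.sym))))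

  Monotone : ∀ {n} → Op n → Set
  Monotone f = ∀ {x y} → x ⊑ y → f ⟨$⟩ x ≤ f ⟨$⟩ y

  record IsAggregation {n} (f : Op n) : Set where
    field
      monotone    : Monotone f
      preserves-0 : f ⟨$⟩ const 0# ≈ 0#
      preserves-1 : f ⟨$⟩ const 1# ≈ 1#

  -- Without coordinates `const 0#` and `const 1#` are the same point, so their prescribed values
  -- would agree.
  ¬aggregation-nullary : (f : Op 0) → ¬ IsAggregation f
  ¬aggregation-nullary f agg =
    0≉1 (≈-trans (≈-sym preserves-0) (≈-trans (Func.cong f λ ()) preserves-1))
    where open IsAggregation agg

  -- `x` is moved to `y` one coordinate at a time: the head is raised first, then induction applies
  -- to `g`, the section of `f` with head frozen at `head y`. The vectors in between agree only
  -- pointwise, hence the uses of `Func.cong`.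
  nondecreasing⇒monotone : ∀ {n} (f : Op n) →
    (∀ i x y → x i ≤ y → f ⟨$⟩ x ≤ f ⟨$⟩ updateAt x i (const y)) → Monotone f
  nondecreasing⇒monotone {zero}  f f-inc x⊑y = ≤-reflexive (Func.cong f λ ())
  nondecreasing⇒monotone {suc n} f f-inc {x} {y} x⊑y = begin
    f ⟨$⟩ x                                 ≤⟨ f-inc zero x (head y) (x⊑y zero) ⟩
    f ⟨$⟩ updateAt x zero (const (head y))  ≈⟨ Func.cong f (λ { zero → ≈-refl ; (suc _) → ≈-refl }) ⟩
    g ⟨$⟩ tail x                            ≤⟨ nondecreasing⇒monotone g g-inc (λ i → x⊑y (suc i)) ⟩
    g ⟨$⟩ tail y                            ≈⟨ Func.cong f (λ { zero → ≈-refl ; (suc _) → ≈-refl }) ⟩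
    f ⟨$⟩ y                                 ∎
    where
    g : Op n
    g = record
      { to   = λ u → f ⟨$⟩ (head y ∷ u)
      ; cong = λ u≈v → Func.cong f λ { zero → ≈-refl ; (suc i) → u≈v i }
      }

    g-inc : ∀ i u z → u i ≤ z → g ⟨$⟩ u ≤ g ⟨$⟩ updateAt u i (const z)
    g-inc i u z uᵢ≤z = begin
      f ⟨$⟩ (head y ∷ u)                              ≤⟨ f-inc (suc i) (head y ∷ u) z uᵢ≤z ⟩
      f ⟨$⟩ updateAt (head y ∷ u) (suc i) (const z)   ≈⟨ Func.cong f (λ { zero → ≈-refl ; (suc _) → ≈-refl }) ⟩
      f ⟨$⟩ (head y ∷ updateAt u i (const z))         ∎

  -- Closure of aggregation functions under the generating operations.

  module _ {n : ℕ} where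
    open IsAggregation

    aggregation-proj : ∀ {f : Op n} i → (∀ x → f ⟨$⟩ x ≈ x i) → IsAggregation f
    aggregation-proj {f} i f≈ = record
      { monotone    = λ {x} {y} x⊑y → begin
          f ⟨$⟩ x   ≈⟨ f≈ x ⟩
          x i       ≤⟨ x⊑y i ⟩
          y i       ≈⟨ f≈ y ⟨
          f ⟨$⟩ y   ∎
      ; preserves-0 = f≈ (const 0#)
      ; preserves-1 = f≈ (const 1#)
      }

    aggregation-χ : ∀ {f g : Op n} a → IsAggregation g →
                    (∀ x → f ⟨$⟩ x ≈ χ a (g ⟨$⟩ x)) → IsAggregation f
    aggregation-χ {f} {g} a agg f≈ = record
      { monotone    = λ {x} {y} x⊑y → begin
          f ⟨$⟩ x         ≈⟨ f≈ x ⟩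
          χ a (g ⟨$⟩ x)   ≤⟨ χ-mono (monotone agg x⊑y) ⟩
          χ a (g ⟨$⟩ y)   ≈⟨ f≈ y ⟨
          f ⟨$⟩ y         ∎
      -- The condition `x ≉ 0#` in `χ` keeps the value `0#` here even when `a` is `0#`.
      ; preserves-0 = begin-equality
          f ⟨$⟩ const 0#         ≈⟨ f≈ (const 0#) ⟩
          χ a (g ⟨$⟩ const 0#)   ≡⟨ ite-false (λ (_ , g0≉0) → g0≉0 (preserves-0 agg)) ⟩
          0#                     ∎
      ; preserves-1 = begin-equality
          f ⟨$⟩ const 1#         ≈⟨ f≈ (const 1#) ⟩
          χ a (g ⟨$⟩ const 1#)   ≡⟨ ite-true (≤-trans (≤1 a) 1≤g1 , ≉0-mono 1≤g1 (0≉1 ∘ ≈-sym)) ⟩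
          1#                     ∎
      }
      where
      1≤g1 : 1# ≤ g ⟨$⟩ const 1#
      1≤g1 = ≤-reflexive (≈-sym (preserves-1 agg))

    aggregation-Med : ∀ {f g h : Op n} b → IsAggregation g → IsAggregation h →
                      (∀ x → f ⟨$⟩ x ≈ Med (g ⟨$⟩ x) (h ⟨$⟩ x) b) → IsAggregation f
    aggregation-Med {f} {g} {h} b agg-g agg-h f≈ = record
      { monotone    = λ {x} {y} x⊑y → begin
          f ⟨$⟩ x                       ≈⟨ f≈ x ⟩
          Med (g ⟨$⟩ x) (h ⟨$⟩ x) b     ≤⟨ Med-mono b (monotone agg-g x⊑y) (monotone agg-h x⊑y) ⟩
          Med (g ⟨$⟩ y) (h ⟨$⟩ y) b     ≈⟨ f≈ y ⟨
          f ⟨$⟩ y                       ∎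
      ; preserves-0 = fixes 0# (preserves-0 agg-g) (preserves-0 agg-h)
      ; preserves-1 = fixes 1# (preserves-1 agg-g) (preserves-1 agg-h)
      }
      where
      fixes : ∀ c → g ⟨$⟩ const c ≈ c → h ⟨$⟩ const c ≈ c → f ⟨$⟩ const c ≈ c
      fixes c gc≈c hc≈c = begin-equality
        f ⟨$⟩ const c                               ≈⟨ f≈ (const c) ⟩
        Med (g ⟨$⟩ const c) (h ⟨$⟩ const c) b       ≈⟨ Med-cong b gc≈c hc≈c ⟩
        Med c c b                                   ≈⟨ Med-idem c b ⟩
        c                                           ∎

    aggregation-sup : ∀ {I : Set} {f : Op n} (g : I → Op n) → I → (∀ i → IsAggregation (g i)) →
                      (∀ x → IsSupremum (λ i → g i ⟨$⟩ x) (f ⟨$⟩ x)) → IsAggregation f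
    aggregation-sup {f = f} g i₀ agg f-sup = record
      { monotone    = λ {x} {y} x⊑y → proj₂ (f-sup x) (f ⟨$⟩ y) λ i →
          ≤-trans (monotone (agg i) x⊑y) (proj₁ (f-sup y) i)
      ; preserves-0 = ≤0⇒≈0 (proj₂ (f-sup (const 0#)) 0# λ i → ≤-reflexive (preserves-0 (agg i)))
      -- An empty supremum would be `0#`; the member `i₀` lifts the value to `1#`.
      ; preserves-1 = ≥1⇒≈1 (begin
          1#                    ≈⟨ preserves-1 (agg i₀) ⟨
          g i₀ ⟨$⟩ const 1#     ≤⟨ proj₁ (f-sup (const 1#)) i₀ ⟩
          f ⟨$⟩ const 1#        ∎)
      }

  -- Step functions of an aggregation function.

  Nonzero : ℕ → Set
  Nonzero n = ∃ λ (a : Vector L n) → ∃ λ i → a i ≉ 0#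

  1-nonzero : ∀ {n} → Nonzero (suc n)
  1-nonzero = const 1# , zero , 0≉1 ∘ ≈-sym

  module _ {n : ℕ} {f : Op (suc n)} (agg : IsAggregation f) where
    open IsAggregation agg

    step : Vector L (suc n) → Vector L (suc n) → L
    step a x = ite (const 1# ⊑ x) 1# (ite (a ⊑ x) (f ⟨$⟩ a) 0#)

    -- Raising `a` raises `f ⟨$⟩ a` but shrinks the set above `a`, so `a` and `b` are compared in
    -- both directions. This form gives monotonicity in `x` and congruence in both arguments.
    step-mono : ∀ {a b x y} → a ⊑ b → b ⊑ a → x ⊑ y → step a x ≤ step b y
    step-mono {b = b} a⊑b b⊑a x⊑y =
      ite-mono (λ 1⊑x i → ≤-trans (1⊑x i) (x⊑y i)) ≤-refl
        (ite-mono (λ a⊑x i → ≤-trans (b⊑a i) (≤-trans (a⊑x i) (x⊑y i)))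
          (monotone a⊑b) ≤-refl (0≤ (f ⟨$⟩ b)))
        (≤1 _)

    step-cong : ∀ {a b x y} → (∀ i → a i ≈ b i) → (∀ i → x i ≈ y i) → step a x ≈ step b y
    step-cong a≈b x≈y = antisym
      (step-mono (≤-reflexive ∘ a≈b) (≤-reflexive ∘ ≈-sym ∘ a≈b) (≤-reflexive ∘ x≈y))
      (step-mono (≤-reflexive ∘ ≈-sym ∘ a≈b) (≤-reflexive ∘ a≈b) (≤-reflexive ∘ ≈-sym ∘ x≈y))

    stepOp : Vector L (suc n) → Op (suc n)
    stepOp a = record { to = step a ; cong = step-cong (λ _ → ≈-refl) }

    -- The top vector lies above `a`, so the first indicator never exceeds the second: equal
    -- indicators return their common value, and the pair `0#`, `1#` returns `f ⟨$⟩ a`.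
    step-Med : ∀ a x → step a x ≈ Med (indicator (const 1# ⊑ x)) (indicator (a ⊑ x)) (f ⟨$⟩ a)
    step-Med a x with em {const 1# ⊑ x} | em {a ⊑ x}
    ... | yes _   | yes _  = ≈-sym (Med-idem 1# (f ⟨$⟩ a))
    ... | yes 1⊑x | no a⋢x = contradiction (λ i → ≤-trans (≤1 (a i)) (1⊑x i)) a⋢x
    ... | no _    | yes _  = ≈-sym (Med-between (0≤ (f ⟨$⟩ a)) (≤1 (f ⟨$⟩ a)))
    ... | no _    | no _   = ≈-sym (Med-idem 0# (f ⟨$⟩ a))

    -- Replaces `step-Med` when `f ⟨$⟩ a` is `1#`, a parameter that the generating medians exclude.
    step-indicator : ∀ a x → f ⟨$⟩ a ≈ 1# → step a x ≈ indicator (a ⊑ x)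
    step-indicator a x fa≈1 with em {const 1# ⊑ x} | em {a ⊑ x}
    ... | yes _   | yes _  = ≈-refl
    ... | yes 1⊑x | no a⋢x = contradiction (λ i → ≤-trans (≤1 (a i)) (1⊑x i)) a⋢x
    ... | no _    | yes _  = fa≈1
    ... | no _    | no _   = ≈-refl

    step≤f : ∀ a x → step a x ≤ f ⟨$⟩ x
    step≤f a x with em {const 1# ⊑ x} | em {a ⊑ x}
    ... | yes 1⊑x | _       = ≤-trans (≤-reflexive (≈-sym preserves-1)) (monotone 1⊑x)
    ... | no _    | yes a⊑x = monotone a⊑x
    ... | no _    | no _    = 0≤ (f ⟨$⟩ x)

    f≤step : ∀ x → f ⟨$⟩ x ≤ step x x
    f≤step x with em {const 1# ⊑ x} | em {x ⊑ x}
    ... | yes _ | _      = ≤1 (f ⟨$⟩ x)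
    ... | no _  | yes _  = ≤-refl
    ... | no _  | no x⋢x = contradiction (λ _ → ≤-refl) x⋢x

    -- At a nonzero `x` the step with `a = x` attains the value. At the zero vector, which is not an
    -- index, `f` is `0#` and so lies below every bound.
    supremum-of-steps : ∀ x → IsSupremum (λ ((a , _) : Nonzero (suc n)) → step a x) (f ⟨$⟩ x)
    supremum-of-steps x = (λ (a , _) → step≤f a x) , least
      where
      least : ∀ t → (∀ ((a , _) : Nonzero (suc n)) → step a x ≤ t) → f ⟨$⟩ x ≤ t
      least t step≤t with em {∃ λ i → x i ≉ 0#}
      ... | yes (i , xᵢ≉0) = ≤-trans (f≤step x) (step≤t (x , i , xᵢ≉0))
      ... | no x≈0 = begin
        f ⟨$⟩ x          ≤⟨ monotone x⊑0 ⟩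
        f ⟨$⟩ const 0#   ≈⟨ preserves-0 ⟩
        0#               ≤⟨ 0≤ t ⟩
        t                ∎
        where
        x⊑0 : x ⊑ const 0#
        x⊑0 i with em {x i ≈ 0#}
        ... | yes xᵢ≈0 = ≤-reflexive xᵢ≈0
        ... | no xᵢ≉0  = contradiction (i , xᵢ≉0) x≈0

  -- Generating indicators of upper sets and step functions.

  module Clone {m : ℕ} (K : Op (suc m) → Set₁)
    (K-proj : ∀ {f} i → (∀ x → f ⟨$⟩ x ≈ x i) → K f)
    (K-χ    : ∀ {f g} a → K g → (∀ x → f ⟨$⟩ x ≈ χ a (g ⟨$⟩ x)) → K f)
    (K-Med  : ∀ {f g h} b → b < 1# → K g → K h →
              (∀ x → f ⟨$⟩ x ≈ Med (g ⟨$⟩ x) (h ⟨$⟩ x) b) → K f)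
    where

    0<1 : 0# < 1#
    0<1 = ≤1 0# , 0≉1

    -- The closure clauses accept any function pointwise equal to their result, and `g` is the
    -- median of itself with itself.
    K-resp-≈ : ∀ {f g} → K g → (∀ x → f ⟨$⟩ x ≈ g ⟨$⟩ x) → K f
    K-resp-≈ {g = g} k f≈g = K-Med 0# 0<1 k k λ x →
      ≈-trans (f≈g x) (≈-sym (Med-idem (g ⟨$⟩ x) 0#))

    -- Asking for some `g` with the values of the indicator leaves respect for pointwise equality to
    -- `g`.
    Characteristic : (Vector L (suc m) → Set) → Set₁
    Characteristic P = ∃ λ g → K g × (∀ x → g ⟨$⟩ x ≈ indicator (P x))

    characteristic-⇔ : ∀ {P Q} → (∀ x → P x → Q x) → (∀ x → Q x → P x) →
                       Characteristic P → Characteristic Q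
    characteristic-⇔ P→Q Q→P (g , k , g≈) =
      g , k , λ x → ≈-trans (g≈ x) (indicator-cong (P→Q x) (Q→P x))

    characteristic-× : ∀ {P Q} → Characteristic P → Characteristic Q →
                       Characteristic (λ x → P x × Q x)
    characteristic-× {P} {Q} (g , k , g≈) (h , l , h≈) =
      medOp , K-Med 0# 0<1 k l (λ _ → ≈-refl) , λ x → begin-equality
        Med (g ⟨$⟩ x) (h ⟨$⟩ x) 0#            ≈⟨ Med-0 (g ⟨$⟩ x) (h ⟨$⟩ x) ⟩
        (g ⟨$⟩ x) ⊓ (h ⟨$⟩ x)                 ≈⟨ ⊓-cong (g≈ x) (h≈ x) ⟩
        indicator (P x) ⊓ indicator (Q x)     ≈⟨ ⊓-indicator (P x) (Q x) ⟩
        indicator (P x × Q x)                 ∎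
      where
      medOp : Op (suc m)
      medOp = record
        { to   = λ x → Med (g ⟨$⟩ x) (h ⟨$⟩ x) 0#
        ; cong = λ x≈y → Med-cong 0# (Func.cong g x≈y) (Func.cong h x≈y)
        }

    -- The conjunct B serves the case k = 0, as the constant function 1# need not be in K.
    characteristic-∀ : ∀ k {B} {P : Fin k → Vector L (suc m) → Set} → Characteristic B →
                       (∀ i → Characteristic (λ x → B x × P i x)) →
                       Characteristic (λ x → B x × (∀ i → P i x))
    characteristic-∀ zero    cB cP = characteristic-⇔ (λ _ b → b , λ ()) (λ _ → proj₁) cB
    characteristic-∀ (suc k) cB cP = characteristic-⇔
      (λ _ ((b , p) , (_ , ps)) → b , λ { zero → p ; (suc i) → ps i })
      (λ _ (b , ps) → (b , ps zero) , (b , λ i → ps (suc i)))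
      (characteristic-× (cP zero) (characteristic-∀ k cB (λ i → cP (suc i))))

    -- For nonzero `a`, whatever lies above `a` is nonzero, so `χ a` tests exactly `a ≤ x i`.
    characteristic-≥ : ∀ {a} → a ≉ 0# → ∀ i → Characteristic (λ x → a ≤ x i)
    characteristic-≥ {a} a≉0 i =
      characteristic-⇔ (λ _ → proj₁) (λ _ a≤xᵢ → a≤xᵢ , ≉0-mono a≤xᵢ a≉0)
        (chiOp , K-χ a (K-proj {f = projOp} i (λ _ → ≈-refl)) (λ _ → ≈-refl) , λ _ → ≈-refl)
      where
      projOp chiOp : Op (suc m)
      projOp = record { to = λ x → x i ; cong = λ x≈y → x≈y i }
      chiOp  = record { to = λ x → χ a (x i) ; cong = λ x≈y → χ-cong (x≈y i) }

    -- A coordinate with a i ≈ 0# imposes no condition and must be skipped, since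
    -- χ 0# vanishes at 0#.
    characteristic-⊒ : ∀ ((a , _) : Nonzero (suc m)) → Characteristic (a ⊑_)
    characteristic-⊒ (a , i₀ , aᵢ₀≉0) =
      characteristic-⇔ (λ _ → proj₂) (λ _ a⊑x → a⊑x i₀ , a⊑x) (characteristic-∀ (suc m) base both)
      where
      base : Characteristic (λ x → a i₀ ≤ x i₀)
      base = characteristic-≥ aᵢ₀≉0 i₀

      both : ∀ i → Characteristic (λ x → a i₀ ≤ x i₀ × a i ≤ x i)
      both i with em {a i ≈ 0#}
      ... | yes aᵢ≈0 = characteristic-⇔
        (λ x b → b , ≤-trans (≤-reflexive aᵢ≈0) (0≤ (x i))) (λ _ → proj₁) base
      ... | no aᵢ≉0 = characteristic-× base (characteristic-≥ aᵢ≉0 i)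

    -- At const 1# every step function must take the value 1#, which the first
    -- argument of the median achieves.
    step-generated : ∀ {f} (agg : IsAggregation f) ((a , _) : Nonzero (suc m)) → K (stepOp agg a)
    step-generated {f} agg a⁺@(a , _)
      with em {f ⟨$⟩ a ≈ 1#} | characteristic-⊒ 1-nonzero | characteristic-⊒ a⁺
    ... | yes fa≈1 | _ | g , k , g≈ =
      K-resp-≈ k λ x → ≈-trans (step-indicator agg a x fa≈1) (≈-sym (g≈ x))
    ... | no fa≉1 | h , l , h≈ | g , k , g≈ =
      K-Med (f ⟨$⟩ a) (≤1 (f ⟨$⟩ a) , fa≉1) l k λ x →
        ≈-trans (step-Med agg a x) (≈-sym (Med-cong (f ⟨$⟩ a) (h≈ x) (g≈ x)))

-- The unit interval: coding of points and the two inclusions.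

module Aggregation (em : ExcludedMiddle 0ℓ) where

  open Classical em

  0≉1 : 0# ≉ 1#
  -- The rational zero separates the cuts: it is below one but not below zero, and both facts
  -- compute.
  0≉1 (_ , 1≤0) = 1≤0 0ℚ tt

  open BoundedChain em 𝕀-totalOrder 0# 1# 0≤value value≤1 0≉1
    hiding (χ; Med; IsSupremum; Op)

  𝒞⇒IsAggregation : ∀ {n} {f : Op n} → 𝒞 f → IsAggregation f
  𝒞⇒IsAggregation (proj i f≈)         = aggregation-proj i f≈
  𝒞⇒IsAggregation (chi a c f≈)        = aggregation-χ a (𝒞⇒IsAggregation c) f≈
  𝒞⇒IsAggregation (med b _ c d f≈)    = aggregation-Med b (𝒞⇒IsAggregation c) (𝒞⇒IsAggregation d) f≈
  𝒞⇒IsAggregation (sup _ i₀ _ g c f≈) = aggregation-sup (g ⟨$⟩_) i₀ (λ i → 𝒞⇒IsAggregation (c i)) f≈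

  𝒞⇒Agg : ∀ {n} {f : Op n} → 𝒞 f → Agg f
  𝒞⇒Agg c = record
    { nondecreasing = λ i x y xᵢ≤y → monotone (⊑-updateAt i x y xᵢ≤y)
    ; preserves-0   = preserves-0
    ; preserves-1   = preserves-1
    }
    where open IsAggregation (𝒞⇒IsAggregation c)

  Agg⇒IsAggregation : ∀ {n} {f : Op n} → Agg f → IsAggregation f
  Agg⇒IsAggregation {f = f} agg = record
    { monotone    = nondecreasing⇒monotone f nondecreasing
    ; preserves-0 = preserves-0
    ; preserves-1 = preserves-1
    }
    where open Agg agg

  coordinates : ∀ n → Countable (Fin (suc n) × ℚ)
  coordinates n = countable-× (countable-Fin n) countable-ℚ

  code : ∀ {n} → Vector 𝕀 (suc n) → ℕ → Bool
  code {n} a k = let (i , q) = proj₁ (coordinates n) k in below (value (a i)) q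

  -- Every pair `(i , q)` occurs in the enumeration, so equal codes give each coordinate the same
  -- cut.
  code-injective : ∀ {n} (a b : Vector 𝕀 (suc n)) → (∀ k → code a k ≡ code b k) → ∀ i → a i ≈ b i
  code-injective {n} a b eq i =
    (λ q → subst T (agree q)) , (λ q → subst T (≡.sym (agree q)))
    where
    agree : ∀ q → below (value (a i)) q ≡ below (value (b i)) q
    agree q =
      let (k , k↦) = proj₂ (coordinates n) (i , q)
      in subst (λ (j , r) → below (value (a j)) r ≡ below (value (b j)) r) k↦ (eq k)

  Agg⇒𝒞 : ∀ {n} (f : Op n) → Agg f → 𝒞 f
  Agg⇒𝒞 {zero}  f agg = contradiction (Agg⇒IsAggregation agg) (¬aggregation-nullary f)
  Agg⇒𝒞 {suc n} f agg = sup I 1-nonzero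
    (record { to = code ∘ proj₁ ; cong = id ; injective = id })
    (record { to   = λ (a , _) → stepOp agg′ a
            ; cong = λ {(a , _)} {(b , _)} a~b x →
                step-cong agg′ {a} {b} {x} {x} (code-injective a b a~b)
                  (λ i → Setoid.refl 𝕀-setoid {x i}) })
    (Clone.step-generated 𝒞 proj chi med agg′)
    (supremum-of-steps agg′)
    where
    agg′ : IsAggregation f
    agg′ = Agg⇒IsAggregation agg

    -- Points are identified when their codes agree: injectivity of the coding is then
    -- needed for the family of step functions to be well defined.
    I : Setoid 0ℓ 0ℓ
    I = On.setoid (ℕ →-setoid Bool) (code ∘ proj₁)

theorem1 : (em : ExcludedMiddle 0ℓ) → let open Classical em in
    ∀ n (f : Op n) → 𝒞 f ⇔ Agg f
theorem1 em n f = mk⇔ 𝒞⇒Agg (Agg⇒𝒞 f)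
  where open Aggregation em
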